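{- Let $\mathsf{CS}$ be an axiomatically appropriate constant specification for $\mathsf{JNoC}$. Then $\mathsf{JNoC}_{\mathsf{CS}}\vdash\neg(t:\perp)$ for each term $t$.
   Context: Justification terms are built from countably many constants $c_i$ and countably many variables $x_i$ by $t::=c_i\mid x_i\mid t\cdot t\mid (t+t)\mid\, !t$. Formulas are built from countably many atomic propositions $P_i$ and $\perp$ by $F::=P_i\mid\perp\mid F\to F\mid t:F$; the set of formulas is $\mathcal{L}_J$. The other Boolean connectives are defined as usual from $\to,\perp$; in particular $\neg A:=A\to\perp$ and $\top:=\neg\perp$. The axioms of $\mathsf{JNoC}$ are (for all terms $s,t$ and formulas $A,B$): (cl) all axioms of classical propositional logic (in the language $\mathcal{L}_J$); (j+) $s:A\lor t:A\to (s+t):A$; (j) $s:(A\to B)\to(t:A\to s\cdot t:B)$; (noc) $\neg(t:A\land t:\neg A)$. A constant specification for $\mathsf{JNoC}$ is a set $\mathsf{CS}\subseteq\{(c,A)\mid c\text{ a constant and }A\text{ an axiom of }\mathsf{JNoC}\}$; it is axiomatically appropriate if for each axiom $A$ of $\mathsf{JNoC}$ there is a constant $c$ with $(c,A)\in\mathsf{CS}$. Write $!^n c$ for $c$ prefixed by $n$ copies of $!$. The logic $\mathsf{JNoC}_{\mathsf{CS}}$ is given by the axioms of $\mathsf{JNoC}$ and the rules modus ponens (from $A$ and $A\to B$ infer $B$) and axiom necessitation: for every $(c,A)\in\mathsf{CS}$ and $n\in\mathbb{N}$ (including $n=0$), infer $!^n c:\,!^{n-1}c:\cdots:\,!c:c:A$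 (for $n=0$ this is $c:A$). $\mathsf{JNoC}_{\mathsf{CS}}\vdash F$ means $F$ is derivable. -}

module Defs where

open import Data.Nat.Base using (ℕ; zero; suc)
open import Data.Product.Base using (_×_; _,_; ∃-syntax)
open import Level using (Level; 0ℓ) renaming (suc to lsuc)
open import Relation.Unary using (Pred; _∈_)

private
  variable
    ℓ : Level

infix  30 !_
infixl 29 _·_
infixl 28 _⊕_
infixr 26 ~_ _∶_
infixr 25 _∧_
infixr 24 _∨_
infixr 23 _⇒_
infix  10 _⊢_

Constant : Set
Constant = ℕ

data Term : Set where
  con : Constant → Term
  var : ℕ → Term
  _·_ : Term → Term → Term
  _⊕_ : Term → Term → Term
  !_  : Term → Term

data Formula : Set where
  P   : ℕ → Formula
  ⊥   : Formula
  _⇒_ : Formula → Formula → Formula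
  _∶_ : Term → Formula → Formula

~_ : Formula → Formula
~ A = A ⇒ ⊥

_∨_ : Formula → Formula → Formula
A ∨ B = ~ A ⇒ B

_∧_ : Formula → Formula → Formula
A ∧ B = ~ (A ⇒ ~ B)

-- The standard Hilbert axiom schemes for classical propositional logic over
-- the primitive connectives ⇒ and ⊥ (complete together with modus ponens),
-- instantiated with arbitrary justification formulas.
data ClassicalAxiom : Pred Formula 0ℓ where
  weakening       : ∀ A B   → ClassicalAxiom (A ⇒ B ⇒ A)
  distribution    : ∀ A B C → ClassicalAxiom ((A ⇒ B ⇒ C) ⇒ (A ⇒ B) ⇒ A ⇒ C)
  double-negation : ∀ A     → ClassicalAxiom (~ ~ A ⇒ A)

data Axiom : Pred Formula 0ℓ where
  cl  : ∀ {A}     → ClassicalAxiom A → Axiom A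
  j+  : ∀ s t A   → Axiom (s ∶ A ∨ t ∶ A ⇒ (s ⊕ t) ∶ A)
  j   : ∀ s t A B → Axiom (s ∶ (A ⇒ B) ⇒ t ∶ A ⇒ (s · t) ∶ B)
  noc : ∀ t A     → Axiom (~ (t ∶ A ∧ t ∶ ~ A))

record ConstantSpecification (ℓ : Level) : Set (lsuc ℓ) where
  field
    pairs  : Pred (Constant × Formula) ℓ
    axioms : ∀ {c A} → (c , A) ∈ pairs → Axiom A

open ConstantSpecification public

AxiomaticallyAppropriate : ConstantSpecification ℓ → Set ℓ
AxiomaticallyAppropriate CS = ∀ A → Axiom A → ∃[ c ] (c , A) ∈ pairs CS

!^ : ℕ → Constant → Term
!^ zero    c = con c
!^ (suc n) c = ! (!^ n c)

-- necessitated n c A is  !ⁿc : !ⁿ⁻¹c : ⋯ : !c : c : A.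
necessitated : ℕ → Constant → Formula → Formula
necessitated zero    c A = con c ∶ A
necessitated (suc n) c A = !^ (suc n) c ∶ necessitated n c A

-- Derivability in JNoC_CS.
data _⊢_ (CS : ConstantSpecification ℓ) : Pred Formula ℓ where
  axiom               : ∀ {A} → Axiom A → CS ⊢ A
  modus-ponens        : ∀ {A B} → CS ⊢ A → CS ⊢ A ⇒ B → CS ⊢ B
  axiom-necessitation : ∀ {c A} → (c , A) ∈ pairs CS →
                        ∀ n → CS ⊢ necessitated n c A

{-# OPTIONS --safe #-}

-- Both ⊥ ⇒ ~ ⊥ and ⊥ ⇒ ~ ~ ⊥ are instances of weakening, hence justified by
-- constants c and d.  Their constants may differ, but the sum c ⊕ d justifies
-- both, so t : ⊥ makes the single term (c ⊕ d) · t justify ~ ⊥ as well as ~ ~ ⊥,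
-- against noc.
module Submission where

open import Defs
open import Data.Product.Base using (_,_)

private
  module _ {ℓ} {CS : ConstantSpecification ℓ} where

    weaken : ∀ {A B} → CS ⊢ B → CS ⊢ A ⇒ B
    weaken b = modus-ponens b (axiom (cl (weakening _ _)))

    -- Replaces the deduction theorem: `A` acts as a standing hypothesis.
    modus-ponens-under : ∀ {A B C} → CS ⊢ A ⇒ B → CS ⊢ A ⇒ B ⇒ C → CS ⊢ A ⇒ C
    modus-ponens-under ab abc =
      modus-ponens ab (modus-ponens abc (axiom (cl (distribution _ _ _))))

    identity : ∀ {A} → CS ⊢ A ⇒ A
    identity {A} =
      modus-ponens-under {B = A ⇒ A} (axiom (cl (weakening _ _))) (axiom (cl (weakening _ _)))

    ex-falso : ∀ {A} → CS ⊢ ⊥ ⇒ A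
    -- As `~ ~ A` is `~ A ⇒ ⊥`, weakening gives `⊥ ⇒ ~ ~ A`.
    ex-falso = modus-ponens-under (axiom (cl (weakening _ _)))
                                  (weaken (axiom (cl (double-negation _))))

    ∨-introˡ : ∀ {A B} → CS ⊢ A → CS ⊢ A ∨ B
    -- The disjunction unfolds to `~ A ⇒ B`: under `~ A`, the given `A` yields `⊥`, hence `B`.
    ∨-introˡ a = modus-ponens-under (modus-ponens-under (weaken a) identity) (weaken ex-falso)

    ∨-introʳ : ∀ {A B} → CS ⊢ B → CS ⊢ A ∨ B
    ∨-introʳ = weaken

    ⊕-introˡ : ∀ {s t A} → CS ⊢ s ∶ A → CS ⊢ (s ⊕ t) ∶ A
    ⊕-introˡ p = modus-ponens (∨-introˡ p) (axiom (j+ _ _ _))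

    ⊕-introʳ : ∀ {s t A} → CS ⊢ t ∶ A → CS ⊢ (s ⊕ t) ∶ A
    ⊕-introʳ p = modus-ponens (∨-introʳ p) (axiom (j+ _ _ _))

    ·-intro : ∀ {s t A B} → CS ⊢ s ∶ (A ⇒ B) → CS ⊢ t ∶ A ⇒ (s · t) ∶ B
    ·-intro p = modus-ponens p (axiom (j _ _ _ _))

    -- Unfolding _∧_, noc is the double negation of this implication.
    consistent : ∀ t A → CS ⊢ t ∶ A ⇒ ~ (t ∶ ~ A)
    consistent t A = modus-ponens (axiom (noc t A)) (axiom (cl (double-negation _)))

lemma22 : ∀ {ℓ} (CS : ConstantSpecification ℓ) → AxiomaticallyAppropriate CS →
    ∀ t → CS ⊢ ~ (t ∶ ⊥)
lemma22 CS appropriate t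
  with appropriate (⊥ ⇒ ~ ⊥) (cl (weakening ⊥ ⊥))
     | appropriate (⊥ ⇒ ~ ~ ⊥) (cl (weakening ⊥ (~ ⊥)))
... | c , c∈CS | d , d∈CS =
  -- Under `t ∶ ⊥`, the outer step supplies `~ ~ ⊥` and the inner one `~ ⊥`, the two premises of
  -- `consistent` at `~ ⊥`.
  modus-ponens-under (·-intro (⊕-introʳ (axiom-necessitation d∈CS 0)))
    (modus-ponens-under (·-intro (⊕-introˡ (axiom-necessitation c∈CS 0)))
      (weaken (consistent ((con c ⊕ con d) · t) (~ ⊥))))
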